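{- Let $S$ be a lattice of finite length and let $(L_x)_{x\in S}$ be an $S$-glued system of $n$-distributive lattices of finite length. Then the $S$-glued sum $L$ is $n$-distributive.
   Context: A partially ordered set is of finite length if every chain in it is finite. Write $x\prec y$ if $y$ covers $x$. Following Huhn, a lattice is $n$-distributive if it is modular and satisfies the identity $$x\cdot\sum_{i=0}^n y_i=\sum_{j=0}^n\Big(x\cdot\sum_{i=0,\,i\ne j}^n y_i\Big),$$ where $+$ and $\sum$ denote join and $\cdot$ denotes meet. $S$ has order $\le$, join $\vee$ and meet $\wedge$. Each $L_x$ has order $\le_x$; the underlying sets need not be disjoint. The family is an $S$-glued system if for all $x,y\in S$: (1) if $x\le y$ and $L_x\cap L_y\ne\emptyset$, then $L_x\cap L_y$ is a filter of $L_x$ and an ideal of $L_y$; (2) if $x\le y$, then for $a,b\in L_x\cap L_y$ we have $a\le_x b\iff a\le_y b$; (3) if $x\prec y$, then $L_x\cap L_y\ne\emptyset$; (4) $L_x\cap L_y\subseteq L_{x\wedge y}\cap L_{x\vee y}$. A filter is a nonempty up-closed subset closed under meets; an ideal is the dual notion. The $S$-glued sum is $L=\bigcup_x L_x$, ordered by the transitive closure of $\bigcup_x\le_x$. It is a lattice. -}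

module Defs where

open import Level using (0ℓ)
open import Data.Nat using (ℕ; zero; suc; NonZero)
open import Data.Fin using (Fin; zero; suc; punchIn)
open import Data.Product using (Σ; ∃; _×_; _,_)
open import Data.Sum using (_⊎_)
open import Data.List using (List)
open import Data.List.Membership.Propositional using (_∈_)
open import Relation.Binary.PropositionalEquality using (_≡_; _≢_)
open import Relation.Binary.Construct.Closure.Transitive using (TransClosure)
import Relation.Binary.Lattice.Structures as LS

-- Lattices living on a subset P of an ambient type U (needed because the
-- underlying sets of the L_x need not be disjoint).

record LatticeOps {U : Set} (P : U → Set) (_≤_ : U → U → Set) : Set where
  field
    _∨_ _∧_  : U → U → U
    ∨-closed : ∀ {a b} → P a → P b → P (a ∨ b)
    ∧-closed : ∀ {a b} → P a → P b → P (a ∧ b)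
    ∨-upperˡ : ∀ {a b} → P a → P b → a ≤ (a ∨ b)
    ∨-upperʳ : ∀ {a b} → P a → P b → b ≤ (a ∨ b)
    ∨-least  : ∀ {a b c} → P a → P b → P c → a ≤ c → b ≤ c → (a ∨ b) ≤ c
    ∧-lowerˡ : ∀ {a b} → P a → P b → (a ∧ b) ≤ a
    ∧-lowerʳ : ∀ {a b} → P a → P b → (a ∧ b) ≤ b
    ∧-greatest : ∀ {a b c} → P a → P b → P c → c ≤ a → c ≤ b → c ≤ (a ∧ b)

record IsPosetOn {U : Set} (P : U → Set) (_≤_ : U → U → Set) : Set where
  field
    refl    : ∀ {a} → P a → a ≤ a
    antisym : ∀ {a b} → P a → P b → a ≤ b → b ≤ a → a ≡ b
    trans   : ∀ {a b c} → P a → P b → P c → a ≤ b → b ≤ c → a ≤ c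

record LatticeOn {U : Set} (P : U → Set) (_≤_ : U → U → Set) : Set where
  field
    isPoset : IsPosetOn P _≤_
    ops     : LatticeOps P _≤_
  open LatticeOps ops public

FiniteLength : {U : Set} (P : U → Set) (_≤_ : U → U → Set) → Set₁
FiniteLength {U} P _≤_ =
  (C : U → Set) → (∀ {a} → C a → P a) →
  (∀ {a b} → C a → C b → (a ≤ b) ⊎ (b ≤ a)) →
  Σ (List U) λ xs → ∀ {a} → C a → a ∈ xs

⋁ : {U : Set} → (U → U → U) → (k : ℕ) → .{{NonZero k}} → (Fin k → U) → U
⋁ _∨_ (suc zero)    f = f zero
⋁ _∨_ (suc (suc k)) f = f zero ∨ ⋁ _∨_ (suc k) (λ i → f (suc i))

Modular : {U : Set} (P : U → Set) (_≤_ : U → U → Set) → LatticeOps P _≤_ → Set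
Modular P _≤_ L = ∀ {a b c} → P a → P b → P c → a ≤ c →
  (a ∨ (b ∧ c)) ≡ ((a ∨ b) ∧ c)
  where open LatticeOps L

-- Huhn's n-distributivity (n ≥ 1): modular and
--   x · Σ_{i=0}^n y_i = Σ_{j=0}^n ( x · Σ_{i≠j} y_i ).
-- The indices i ≠ j are enumerated as punchIn j : Fin n → Fin (suc n).
NDistributive : {U : Set} (P : U → Set) (_≤_ : U → U → Set) →
                LatticeOps P _≤_ → (n : ℕ) → .{{NonZero n}} → Set
NDistributive P _≤_ L n =
  Modular P _≤_ L ×
  (∀ x (y : Fin (suc n) → _) → P x → (∀ i → P (y i)) →
    (x ∧ ⋁ _∨_ (suc n) y) ≡
    ⋁ _∨_ (suc n) (λ j → x ∧ ⋁ _∨_ n (λ i → y (punchIn j i))))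
  where open LatticeOps L

IsLatticeS : {S : Set} (_≤_ : S → S → Set) (_∨_ _∧_ : S → S → S) → Set
IsLatticeS {S} _≤_ _∨_ _∧_ = LS.IsLattice {A = S} _≡_ _≤_ _∨_ _∧_

Covers : {S : Set} (_≤_ : S → S → Set) → S → S → Set
Covers _≤_ x y = (x ≤ y) × (x ≢ y) × (∀ z → x ≤ z → z ≤ y → (z ≡ x) ⊎ (z ≡ y))

IsFilter : {U : Set} {P : U → Set} {_≤_ : U → U → Set} →
           LatticeOn P _≤_ → (U → Set) → Set
IsFilter {U} {P} {_≤_} L F =
  (∀ {a} → F a → P a) × (∃ λ a → F a) ×
  (∀ {a b} → F a → P b → a ≤ b → F b) ×
  (∀ {a b} → F a → F b → F (a ∧ b))
  where open LatticeOn L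

IsIdeal : {U : Set} {P : U → Set} {_≤_ : U → U → Set} →
          LatticeOn P _≤_ → (U → Set) → Set
IsIdeal {U} {P} {_≤_} L I =
  (∀ {a} → I a → P a) × (∃ λ a → I a) ×
  (∀ {a b} → I a → P b → b ≤ a → I b) ×
  (∀ {a b} → I a → I b → I (a ∨ b))
  where open LatticeOn L

-- S-glued systems. The family is given by membership predicates
-- Mem x : U → Set (the underlying set of L_x) and orders R x.

record IsGluedSystem {S U : Set} (_≤_ : S → S → Set) (_∨_ _∧_ : S → S → S)
       (Mem : S → U → Set) (R : S → U → U → Set)
       (Lat : (x : S) → LatticeOn (Mem x) (R x)) : Set where
  Inter : S → S → U → Set
  Inter x y a = Mem x a × Mem y a
  field
    glue-filter-ideal : ∀ {x y} → x ≤ y → (∃ λ a → Inter x y a) →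
      IsFilter (Lat x) (Inter x y) × IsIdeal (Lat y) (Inter x y)
    glue-order : ∀ {x y} → x ≤ y → ∀ {a b} → Inter x y a → Inter x y b →
      (R x a b → R y a b) × (R y a b → R x a b)
    glue-cover : ∀ {x y} → Covers _≤_ x y → ∃ λ a → Inter x y a
    glue-meet-join : ∀ {x y a} → Inter x y a →
      Mem (x ∧ y) a × Mem (x ∨ y) a

GluedCarrier : {S U : Set} → (S → U → Set) → U → Set
GluedCarrier {S} Mem a = ∃ λ (x : S) → Mem x a

GluedStep : {S U : Set} → (S → U → Set) → (S → U → U → Set) → U → U → Set
GluedStep {S} Mem R a b = ∃ λ (x : S) → Mem x a × Mem x b × R x a b

GluedOrder : {S U : Set} → (S → U → Set) → (S → U → U → Set) → U → U → Set
GluedOrder Mem R = TransClosure (GluedStep Mem R)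

{-# OPTIONS --safe #-}
module Submission where

-- In a glued sum an ascending path issuing from L_z can be lifted into blocks L_v with z ≤ v, and
-- if it returns to L_z the ideal condition pulls all of it back into L_z.  So every L_z is a convex
-- sublattice of L, every relation a ≤ b is a finite path of steps inside blocks, and two steps
-- with a common lower (or upper) end lie in a common block.  Steps are preserved by joining or
-- meeting both ends with a fixed element, so the modular law spreads from blocks to L by
-- induction along a path.  If the n-distributive law fails for x, y₀, …, yₙ, it fails by a step
-- D ≤ X.  With Yⱼ the join of the yᵢ, i ≠ j, this step transposes to the steps
-- yⱼ ∧ Yⱼ ≤ yⱼ ∧ (X ∨ Yⱼ); joined with the element ⋁ⱼ (yⱼ ∧ Yⱼ), all of them start at one
-- point, hence lie in one block, where n-distributivity makes the step trivial.

open import Defs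
open import Level using (0ℓ)
open import Data.Nat using (ℕ; zero; suc; NonZero)
open import Data.Fin using (Fin; zero; suc; punchIn; punchOut)
open import Data.Fin.Properties using (_≟_; punchInᵢ≢i; punchIn-punchOut; suc-injective)
open import Data.Product using (∃; _×_; _,_; proj₁; proj₂)
open import Data.Sum using (_⊎_; inj₁; inj₂)
open import Data.Unit using (⊤)
open import Function using (_∘_; case_of_)
open import Relation.Nullary using (yes; no)
open import Relation.Binary.PropositionalEquality using (_≡_; _≢_; refl; sym; trans; cong; cong₂; subst)
open import Relation.Binary.Construct.Closure.Transitive using ([_]; _∷_; _++_)
open import Relation.Binary.Construct.Closure.ReflexiveTransitive using (Star; ε; _◅_; reverse)
open import Relation.Binary.Lattice using (Lattice; IsLattice)
import Relation.Binary.Lattice.Properties.JoinSemilattice as JoinProperties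
import Relation.Binary.Lattice.Properties.MeetSemilattice as MeetProperties
import Relation.Binary.Lattice.Properties.Lattice as LatticeProperties
import Relation.Binary.Reasoning.PartialOrder as PartialOrderReasoning

-- Finite joins.

⋁-homo : {A B : Set} (h : A → B) (Q : A → Set) (_∨₁_ : A → A → A) (_∨₂_ : B → B → B) →
         (∀ {a b} → Q a → Q b → Q (a ∨₁ b)) →
         (∀ {a b} → Q a → Q b → h (a ∨₁ b) ≡ h a ∨₂ h b) →
         ∀ k (f : Fin (suc k) → A) {g : Fin (suc k) → B} →
         (∀ i → Q (f i)) → (∀ i → h (f i) ≡ g i) →
         Q (⋁ _∨₁_ (suc k) f) × h (⋁ _∨₁_ (suc k) f) ≡ ⋁ _∨₂_ (suc k) g
⋁-homo h Q _∨₁_ _∨₂_ closed homo zero f q e = q zero , e zero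
⋁-homo h Q _∨₁_ _∨₂_ closed homo (suc k) f q e =
  let q′ , e′ = ⋁-homo h Q _∨₁_ _∨₂_ closed homo k (f ∘ suc) (q ∘ suc) (e ∘ suc)
  in closed (q zero) q′ , trans (homo (q zero) q′) (cong₂ _∨₂_ (e zero) e′)

module FiniteJoins (L : Lattice 0ℓ 0ℓ 0ℓ) where
  open Lattice L hiding (refl; trans)
  open Lattice L using () renaming (refl to ≤-refl; trans to ≤-trans)
  open JoinProperties joinSemilattice using (∨-monotonic)
  open PartialOrderReasoning poset

  ⋁-upper : ∀ k (f : Fin (suc k) → Carrier) i → f i ≤ ⋁ _∨_ (suc k) f
  ⋁-upper zero    f zero    = ≤-refl
  ⋁-upper (suc k) f zero    = x≤x∨y _ _
  ⋁-upper (suc k) f (suc i) = ≤-trans (⋁-upper k (f ∘ suc) i) (y≤x∨y _ _)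

  ⋁-least : ∀ k (f : Fin (suc k) → Carrier) {c} → (∀ i → f i ≤ c) → ⋁ _∨_ (suc k) f ≤ c
  ⋁-least zero    f f≤c = f≤c zero
  ⋁-least (suc k) f f≤c = ∨-least (f≤c zero) (⋁-least k (f ∘ suc) (f≤c ∘ suc))

  ⋁-mono : ∀ k (f g : Fin (suc k) → Carrier) → (∀ i → f i ≤ g i) → ⋁ _∨_ (suc k) f ≤ ⋁ _∨_ (suc k) g
  ⋁-mono k f g f≤g = ⋁-least k f (λ i → ≤-trans (f≤g i) (⋁-upper k g i))

  -- The summands are exchanged one at a time, with `C` collecting those already replaced. When
  -- `f j` is replaced, all other summands form the `A` of `replace`; the bounds by `W j` keep it
  -- admissible.
  ⋁-exchange : ∀ {X} k (f g W : Fin (suc k) → Carrier) {C} →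
    (∀ j {A} → A ≤ W j → X ≤ A ∨ f j → X ≤ A ∨ g j) →
    (∀ j → C ≤ W j) → (∀ {i j} → i ≢ j → f i ≤ W j) → (∀ {i j} → i ≢ j → g i ≤ W j) →
    X ≤ C ∨ ⋁ _∨_ (suc k) f → X ≤ C ∨ ⋁ _∨_ (suc k) g
  ⋁-exchange zero f g W replace C≤W _ _ X≤ = replace zero (C≤W zero) X≤
  ⋁-exchange {X} (suc k) f g W {C} replace C≤W f≤W g≤W X≤ = begin
    X                ≤⟨ ⋁-exchange k (f ∘ suc) (g ∘ suc) (W ∘ suc) (replace ∘ suc)
                          (λ j → ∨-least (C≤W (suc j)) (g≤W λ ()))
                          (λ i≢j → f≤W (i≢j ∘ suc-injective))
                          (λ i≢j → g≤W (i≢j ∘ suc-injective))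
                          X≤C∨g₀∨F ⟩
    (C ∨ g zero) ∨ G ≤⟨ ∨-least (∨-monotonic ≤-refl (x≤x∨y _ _)) (≤-trans (y≤x∨y _ _) (y≤x∨y _ _)) ⟩
    C ∨ (g zero ∨ G) ∎
    where
    F = ⋁ _∨_ (suc k) (f ∘ suc)
    G = ⋁ _∨_ (suc k) (g ∘ suc)
    X≤C∨g₀∨F : X ≤ (C ∨ g zero) ∨ F
    X≤C∨g₀∨F = begin
      X                ≤⟨ replace zero
                            (∨-least (C≤W zero) (⋁-least k (f ∘ suc) (λ i → f≤W λ ())))
                            (≤-trans X≤ (∨-least (≤-trans (x≤x∨y _ _) (x≤x∨y _ _))
                              (∨-least (y≤x∨y _ _) (≤-trans (y≤x∨y _ _) (x≤x∨y _ _))))) ⟩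
      (C ∨ F) ∨ g zero ≤⟨ ∨-least (∨-monotonic (x≤x∨y _ _) ≤-refl) (≤-trans (y≤x∨y _ _) (x≤x∨y _ _)) ⟩
      (C ∨ g zero) ∨ F ∎

  -- The index is shifted: `n` stands for distributivity of degree `suc n`, so that the remaining
  -- join is never empty.
  omit : ∀ n → (Fin (suc (suc n)) → Carrier) → Fin (suc (suc n)) → Carrier
  omit n y j = ⋁ _∨_ (suc n) (y ∘ punchIn j)

  omit-upper : ∀ n y {i j} → i ≢ j → y i ≤ omit n y j
  omit-upper n y {i} {j} i≢j =
    subst (λ l → y l ≤ omit n y j) (punchIn-punchOut (i≢j ∘ sym)) (⋁-upper n (y ∘ punchIn j) (punchOut (i≢j ∘ sym)))

  omit-least : ∀ n y j {c} → (∀ i → i ≢ j → y i ≤ c) → omit n y j ≤ c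
  omit-least n y j y≤c = ⋁-least n (y ∘ punchIn j) (λ i → y≤c (punchIn j i) (punchInᵢ≢i j i))

  ⋁≤omit∨ : ∀ n y j → ⋁ _∨_ (suc (suc n)) y ≤ omit n y j ∨ y j
  ⋁≤omit∨ n y j = ⋁-least (suc n) y λ i → case i ≟ j of λ where
    (yes refl) → y≤x∨y _ _
    (no i≢j)   → ≤-trans (omit-upper n y i≢j) (x≤x∨y _ _)

-- Lattices with an atlas of modular blocks.

record Atlas (L : Lattice 0ℓ 0ℓ 0ℓ) : Set₁ where
  open Lattice L
  field
    Index : Set
    Block : Index → Carrier → Set
  Step : Carrier → Carrier → Set
  Step a b = a ≤ b × ∃ λ w → Block w a × Block w b
  field
    convex     : ∀ {w a b c} → Block w a → Block w c → a ≤ b → b ≤ c → Block w b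
    ∨-closed   : ∀ {w a b} → Block w a → Block w b → Block w (a ∨ b)
    ∧-closed   : ∀ {w a b} → Block w a → Block w b → Block w (a ∧ b)
    modular    : ∀ {w a b c} → Block w a → Block w b → Block w c → a ≤ c → (a ∨ b) ∧ c ≤ a ∨ (b ∧ c)
    amalgam-up : ∀ {x y p} → Block x p → Block y p →
                 ∃ λ w → ∀ {a} → p ≤ a → Block x a ⊎ Block y a → Block w a
    amalgam-down : ∀ {x y p} → Block x p → Block y p →
                 ∃ λ w → ∀ {a} → a ≤ p → Block x a ⊎ Block y a → Block w a
    path       : ∀ {a b} → a ≤ b → Star Step a b

-- The fields of `Atlas` are symmetric under order reversal, modularity after exchanging `a` and
-- `c`. Each fact about steps thus comes with its dual.
dual : ∀ {L} → Atlas L → Atlas (LatticeProperties.∧-∨-lattice L)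
dual {L} At = record
  { Index        = Index
  ; Block        = Block
  ; convex       = λ a c b≤a c≤b → convex c a c≤b b≤a
  ; ∨-closed     = ∧-closed
  ; ∧-closed     = ∨-closed
  ; modular      = λ {w} {a} {b} {c} a∈w b∈w c∈w c≤a → begin
      a ∧ (b ∨ c) ≈⟨ ∧-comm _ _ ⟩
      (b ∨ c) ∧ a ≤⟨ ∧-monotonic (reflexive (∨-comm _ _)) ≤-refl ⟩
      (c ∨ b) ∧ a ≤⟨ modular c∈w b∈w a∈w c≤a ⟩
      c ∨ (b ∧ a) ≤⟨ ∨-monotonic ≤-refl (reflexive (∧-comm _ _)) ⟩
      c ∨ (a ∧ b) ≈⟨ ∨-comm _ _ ⟩
      (a ∧ b) ∨ c ∎
  ; amalgam-up   = amalgam-down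
  ; amalgam-down = amalgam-up
  ; path         = λ b≤a → reverse (λ (a≤b , w , a∈w , b∈w) → a≤b , w , b∈w , a∈w) (path b≤a)
  }
  where
  open Atlas At
  open Lattice L using (_∨_; _∧_; poset; joinSemilattice; meetSemilattice; reflexive) renaming (refl to ≤-refl)
  open JoinProperties joinSemilattice using (∨-comm; ∨-monotonic)
  open MeetProperties meetSemilattice using (∧-comm; ∧-monotonic)
  open PartialOrderReasoning poset

-- Transposed steps and modularity across one step.

module StepProperties {L : Lattice 0ℓ 0ℓ 0ℓ} (At : Atlas L) where
  open Atlas At
  open Lattice L hiding (refl; trans)
  open Lattice L using () renaming (refl to ≤-refl; trans to ≤-trans)
  open JoinProperties joinSemilattice using (∨-monotonic)
  open PartialOrderReasoning poset

  path⇒≤ : ∀ {a b} → Star Step a b → a ≤ b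
  path⇒≤ ε                = ≤-refl
  path⇒≤ ((a≤b , _) ◅ bs) = ≤-trans a≤b (path⇒≤ bs)

  Step-truncate : ∀ {a b c} → a ≤ b → b ≤ c → Step a c → Step a b
  Step-truncate a≤b b≤c (_ , w , a∈w , c∈w) = a≤b , w , a∈w , convex a∈w c∈w a≤b b≤c

  common-block : ∀ {p a b} → Step p a → Step p b → ∃ λ w → Block w p × Block w a × Block w b
  common-block (p≤a , x , p∈x , a∈x) (p≤b , y , p∈y , b∈y) =
    let w , up = amalgam-up p∈x p∈y
    in w , up ≤-refl (inj₁ p∈x) , up p≤a (inj₁ a∈x) , up p≤b (inj₂ b∈y)

  -- The block `x` stays in the conclusion for the induction: each amalgamation retains what the
  -- previous block has above `p`. It also lets further elements of `x` share the final block.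
  common-block-family : ∀ {p x} k (f : Fin k → Carrier) → Block x p → (∀ i → Step p (f i)) →
    ∃ λ w → (∀ {a} → p ≤ a → Block x a → Block w a) × (∀ i → Block w (f i))
  common-block-family {x = x} zero f p∈x s = x , (λ _ a∈x → a∈x) , λ ()
  common-block-family (suc k) f p∈x s =
    let p≤a , y , p∈y , a∈y = s zero
        v , up = amalgam-up p∈x p∈y
        w , up′ , f∈w = common-block-family k (f ∘ suc) (up ≤-refl (inj₁ p∈x)) (s ∘ suc)
    in w , (λ p≤b b∈x → up′ p≤b (up p≤b (inj₁ b∈x)))
         , λ { zero → up′ p≤a (up p≤a (inj₂ a∈y)) ; (suc i) → f∈w i }

  -- The first step of the path and the step to `b` start at one point, so a common block contains
  -- the join of their ends. In this way the step climbs the path.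
  Step-∨-path : ∀ {a b p} → Star Step a p → Step a b → Step p (p ∨ b)
  Step-∨-path ε (a≤b , w , a∈w , b∈w) = x≤x∨y _ _ , w , a∈w , ∨-closed a∈w b∈w
  Step-∨-path (s ◅ ss) t =
    let w , _ , p₁∈w , b∈w = common-block s t
    in Step-truncate (x≤x∨y _ _) (∨-monotonic ≤-refl (y≤x∨y _ _))
         (Step-∨-path ss (x≤x∨y _ _ , w , p₁∈w , ∨-closed p₁∈w b∈w))

  Step-∨ : ∀ {a b c} → a ≤ c → Step a b → Step c (c ∨ b)
  Step-∨ a≤c = Step-∨-path (path a≤c)

  -- The step climbs to one from `a₁` to `a₁ ∨ b`, and induction gives the claim with `a₁ ∨ b` in
  -- place of `b`. The part of `v` below `a₁ ∨ b` lies in one block with `a₁` and `b`, where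
  -- modularity brings `b` back.
  modular-below-step : ∀ {c a b v} → Star Step c a → Step c b → a ≤ v → v ≤ a ∨ b → v ≤ a ∨ (v ∧ b)
  modular-below-step ε (c≤b , _) c≤v v≤c∨b =
    ≤-trans (∧-greatest ≤-refl (≤-trans v≤c∨b (∨-least c≤b ≤-refl))) (y≤x∨y _ _)
  modular-below-step {c} {a} {b} {v} (_◅_ {j = a₁} s ss) t a≤v v≤a∨b =
    let w , _ , a₁∈w , b∈w = common-block s t
        b₁∈w = ∨-closed a₁∈w b∈w
        a₁≤a = path⇒≤ ss
        a₁≤v∧b₁ = ∧-greatest (≤-trans a₁≤a a≤v) (x≤x∨y _ _)
        v∧b₁∈w = convex a₁∈w b₁∈w a₁≤v∧b₁ (x∧y≤y _ _)
    in begin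
      v                                ≤⟨ modular-below-step ss (x≤x∨y _ _ , w , a₁∈w , b₁∈w) a≤v
                                            (≤-trans v≤a∨b (∨-monotonic ≤-refl (y≤x∨y _ _))) ⟩
      a ∨ (v ∧ (a₁ ∨ b))               ≤⟨ ∨-monotonic ≤-refl (∧-greatest (x∧y≤y _ _) ≤-refl) ⟩
      a ∨ ((a₁ ∨ b) ∧ (v ∧ (a₁ ∨ b)))  ≤⟨ ∨-monotonic ≤-refl (modular a₁∈w b∈w v∧b₁∈w a₁≤v∧b₁) ⟩
      a ∨ (a₁ ∨ (b ∧ (v ∧ (a₁ ∨ b))))  ≤⟨ ∨-least (x≤x∨y _ _) (∨-monotonic a₁≤a
                                            (∧-greatest (≤-trans (x∧y≤y _ _) (x∧y≤x _ _)) (x∧y≤x _ _))) ⟩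
      a ∨ (v ∧ b)                      ∎

-- The modular law.

module AtlasProperties {L : Lattice 0ℓ 0ℓ 0ℓ} (At : Atlas L) where
  open Atlas At
  open StepProperties At
  private module Dual = StepProperties (dual At)
  open FiniteJoins L
  open Lattice L hiding (refl; trans)
  open Lattice L using () renaming (refl to ≤-refl; trans to ≤-trans)
  open JoinProperties joinSemilattice using (∨-monotonic)
  open MeetProperties meetSemilattice using (∧-monotonic)
  open PartialOrderReasoning poset

  Step-∧ : ∀ {a b c} → c ≤ b → Step a b → Step (c ∧ a) c
  Step-∧ c≤b (a≤b , w , a∈w , b∈w) =
    let c∧a≤c , v , c∈v , c∧a∈v = Dual.Step-∨ c≤b (a≤b , w , b∈w , a∈w)
    in c∧a≤c , v , c∧a∈v , c∈v

  modular-above-step : ∀ {u h t q} → Step u h → t ≤ h → t ∧ u ≤ q → q ≤ t → t ∧ (q ∨ u) ≤ q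
  modular-above-step (u≤h , w , u∈w , h∈w) t≤h t∧u≤q q≤t =
    Dual.modular-below-step (Atlas.path (dual At) t≤h) (u≤h , w , h∈w , u∈w) q≤t t∧u≤q

  -- A pentagon with `p ≤ u` on one side and `s` on the other collapses. After the first step, to
  -- `q`, induction compares `p ∨ q` with `u ∨ q` over `q`: `modular-above-step` supplies its
  -- premise, and `modular-below-step` returns from `p ∨ q` to `p`.
  modular-path : ∀ {c s p u} → Star Step c s → c ≤ p → p ≤ u → u ∧ s ≤ c → (p ∨ s) ∧ u ≤ p
  modular-path ε c≤p _ _ = ≤-trans (x∧y≤x _ _) (∨-least ≤-refl c≤p)
  modular-path {c} {s} {p} {u} (_◅_ {j = q} c⋖q q⋯s) c≤p p≤u u∧s≤c = begin
    (p ∨ s) ∧ u                   ≤⟨ ∧-greatest (∧-monotonic (∨-monotonic (x≤x∨y _ _) ≤-refl) (x≤x∨y _ _)) (x∧y≤y _ _) ⟩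
    (((p ∨ q) ∨ s) ∧ (u ∨ q)) ∧ u ≤⟨ ∧-monotonic (modular-path q⋯s (y≤x∨y _ _) (∨-monotonic p≤u ≤-refl) u∨q∧s≤q) ≤-refl ⟩
    (p ∨ q) ∧ u                   ≤⟨ p∨q∧u≤p ⟩
    p                             ∎
    where
    c≤q = proj₁ c⋖q
    q≤s = path⇒≤ q⋯s
    -- u ≤ u ∨ q is a step, so the modular law for u is available in the interval below u ∨ q.
    u∨q∧s≤q : (u ∨ q) ∧ s ≤ q
    u∨q∧s≤q = begin
      (u ∨ q) ∧ s             ≤⟨ ∧-greatest ≤-refl (≤-trans (x∧y≤x _ _) (∨-least (y≤x∨y _ _) (x≤x∨y _ _))) ⟩
      ((u ∨ q) ∧ s) ∧ (q ∨ u) ≤⟨ modular-above-step (Step-∨ (≤-trans c≤p p≤u) c⋖q) (x∧y≤x _ _)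
                                   (≤-trans (∧-greatest (x∧y≤y _ _) (≤-trans (x∧y≤x _ _) (x∧y≤y _ _))) (≤-trans u∧s≤c c≤q))
                                   (∧-greatest (y≤x∨y _ _) q≤s) ⟩
      q                       ∎
    p∨q∧u≤p : (p ∨ q) ∧ u ≤ p
    p∨q∧u≤p = begin
      (p ∨ q) ∧ u             ≤⟨ modular-below-step (path c≤p) c⋖q (∧-greatest (x≤x∨y _ _) p≤u) (x∧y≤x _ _) ⟩
      p ∨ (((p ∨ q) ∧ u) ∧ q) ≤⟨ ∨-least ≤-refl (≤-trans (∧-monotonic (x∧y≤y _ _) q≤s) (≤-trans u∧s≤c c≤p)) ⟩
      p                       ∎

  -- Once `a` is enlarged to `a ∨ (b ∧ c)`, it lies between `b ∧ c` and `c`, as `modular-path`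
  -- requires along the path from `b ∧ c` to `b`.
  modular-law : ∀ {a b c} → a ≤ c → (a ∨ b) ∧ c ≤ a ∨ (b ∧ c)
  modular-law {a} {b} {c} a≤c = ≤-trans (∧-monotonic (∨-monotonic (x≤x∨y _ _) ≤-refl) ≤-refl)
    (modular-path (path (x∧y≤x b c)) (y≤x∨y _ _) (∨-least a≤c (x∧y≤y _ _)) (∧-greatest (x∧y≤y _ _) (x∧y≤x _ _)))

  -- The distributive law.

  module _ (n : ℕ)
    (block-distrib : ∀ {w} x y → Block w x → (∀ i → Block w (y i)) →
       x ∧ ⋁ _∨_ (suc (suc n)) y ≤ ⋁ _∨_ (suc (suc n)) (λ j → x ∧ omit n y j)) where

    distrib-step : ∀ {D X} y → Step D X → (∀ i → D ≤ y i) → X ≤ ⋁ _∨_ (suc (suc n)) y →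
                   (∀ j → X ∧ omit n y j ≤ D) → X ≤ D
    -- `E` lies below every `Y j`, so `X ≤ E` yields `X ≤ X ∧ Y zero ≤ D`.
    distrib-step {D} {X} y D⋖X D≤y X≤⋁y X∧Y≤D = ≤-trans (∧-greatest ≤-refl (≤-trans X≤E (E≤Y zero))) (X∧Y≤D zero)
      where
      Y z d : Fin (suc (suc n)) → Carrier
      Y = omit n y
      z j = y j ∧ (X ∨ Y j)
      d j = y j ∧ Y j
      E = ⋁ _∨_ (suc (suc n)) d

      D≤Y : ∀ j → D ≤ Y j
      D≤Y j = ≤-trans (D≤y (punchIn j zero)) (⋁-upper n (y ∘ punchIn j) zero)

      E≤Y : ∀ j → E ≤ Y j
      E≤Y j = ⋁-least (suc n) d λ i → case i ≟ j of λ where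
        (yes refl) → x∧y≤y _ _
        (no i≢j)   → ≤-trans (x∧y≤x _ _) (omit-upper n y i≢j)

      d≤E : ∀ j → d j ≤ E
      d≤E = ⋁-upper (suc n) d

      D≤E : D ≤ E
      D≤E = ≤-trans (∧-greatest (D≤y zero) (D≤Y zero)) (d≤E zero)

      z≤Y : ∀ {i j} → i ≢ j → z i ≤ Y j
      z≤Y i≢j = ≤-trans (x∧y≤x _ _) (omit-upper n y i≢j)

      d⋖z : ∀ j → Step (d j) (z j)
      d⋖z j =
        -- The meet is taken with `z j`, not `y j`, because `Step-∧` needs an element below the top
        -- `Y j ∨ X`. The resulting step starts at `z j ∧ Y j`, below `d j`; convexity moves this
        -- end up.
        let _ , w , a∈w , z∈w = Step-∧ {c = z j} (≤-trans (x∧y≤y _ _) (∨-least (y≤x∨y _ _) (x≤x∨y _ _)))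
                                  (Step-∨ (D≤Y j) D⋖X)
            d≤z = ∧-monotonic ≤-refl (y≤x∨y _ _)
        in d≤z , w , convex a∈w z∈w (∧-greatest (≤-trans (x∧y≤x _ _) (x∧y≤x _ _)) (x∧y≤y _ _)) d≤z , z∈w

      replace : ∀ j {A} → A ≤ Y j → X ≤ A ∨ y j → X ≤ A ∨ z j
      replace j {A} A≤Y X≤ = begin
        X                      ≤⟨ ∧-greatest X≤ (x≤x∨y _ _) ⟩
        (A ∨ y j) ∧ (X ∨ Y j)  ≤⟨ modular-law (≤-trans A≤Y (y≤x∨y _ _)) ⟩
        A ∨ z j                ∎

      X≤E∨⋁z : X ≤ E ∨ ⋁ _∨_ (suc (suc n)) z
      X≤E∨⋁z = ⋁-exchange (suc n) y z Y replace E≤Y (omit-upper n y) z≤Y (≤-trans X≤⋁y (y≤x∨y _ _))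

      z′ : Fin (suc (suc n)) → Carrier
      z′ j = E ∨ z j

      E∨X∧≤E : ∀ j → (E ∨ X) ∧ omit n z′ j ≤ E
      E∨X∧≤E j = begin
        (E ∨ X) ∧ omit n z′ j ≤⟨ ∧-monotonic ≤-refl (omit-least n z′ j (λ i i≢j → ∨-least (E≤Y j) (z≤Y i≢j))) ⟩
        (E ∨ X) ∧ Y j         ≤⟨ modular-law (E≤Y j) ⟩
        E ∨ (X ∧ Y j)         ≤⟨ ∨-least ≤-refl (≤-trans (X∧Y≤D j) D≤E) ⟩
        E                     ∎

      X≤E : X ≤ E
      X≤E =
        let E≤E∨X , x , E∈x , E∨X∈x = Step-∨ D≤E D⋖X
            -- Seeding the family with the block of the step from `E` to `E ∨ X` puts `E ∨ X` into
            -- one block with all `z′ j`.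
            w , up , z′∈w = common-block-family (suc (suc n)) z′ E∈x (λ j → Step-∨ (d≤E j) (d⋖z j))
        in begin
          X                                   ≤⟨ ∧-greatest (y≤x∨y _ _) (≤-trans X≤E∨⋁z (∨-least
                                                   (≤-trans (x≤x∨y _ _) (⋁-upper (suc n) z′ zero))
                                                   (⋁-mono (suc n) z z′ (λ i → y≤x∨y _ _)))) ⟩
          (E ∨ X) ∧ ⋁ _∨_ (suc (suc n)) z′    ≤⟨ block-distrib (E ∨ X) z′ (up E≤E∨X E∨X∈x) z′∈w ⟩
          ⋁ _∨_ (suc (suc n)) (λ j → (E ∨ X) ∧ omit n z′ j)
                                              ≤⟨ ⋁-least (suc n) _ E∨X∧≤E ⟩
          E                                   ∎

    -- The end of the first step lies below `X` and so inherits the premises. `distrib-step`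
    -- collapses it onto `D`, and the rest of the path can start there.
    distrib-path : ∀ {D X} y → Star Step D X → (∀ i → D ≤ y i) → X ≤ ⋁ _∨_ (suc (suc n)) y →
                   (∀ j → X ∧ omit n y j ≤ D) → X ≤ D
    distrib-path y ε _ _ _ = ≤-refl
    distrib-path y (s ◅ ss) D≤y X≤⋁y X∧Y≤D =
      let D₁≤X = path⇒≤ ss
          D₁≤D = distrib-step y s D≤y (≤-trans D₁≤X X≤⋁y) (λ j → ≤-trans (∧-monotonic D₁≤X ≤-refl) (X∧Y≤D j))
      in ≤-trans (distrib-path y ss (λ i → ≤-trans D₁≤D (D≤y i)) X≤⋁y (λ j → ≤-trans (X∧Y≤D j) (proj₁ s))) D₁≤D

    distrib-law : ∀ x y → x ∧ ⋁ _∨_ (suc (suc n)) y ≈ ⋁ _∨_ (suc (suc n)) (λ j → x ∧ omit n y j)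
    distrib-law x y = antisym
      (distrib-path y′ (path D≤X) (λ i → x≤x∨y _ _)
        (≤-trans (x∧y≤y _ _) (⋁-mono (suc n) y y′ (λ i → y≤x∨y _ _)))
        X∧Y′≤D)
      D≤X
      where
      X = x ∧ ⋁ _∨_ (suc (suc n)) y
      D = ⋁ _∨_ (suc (suc n)) (λ j → x ∧ omit n y j)
      -- `distrib-path` wants the joinands above `D`. Joining `D` to each is harmless: since
      -- `D ≤ X`, the modular law splits it off again.
      y′ : Fin (suc (suc n)) → Carrier
      y′ i = D ∨ y i
      D≤X : D ≤ X
      D≤X = ⋁-least (suc n) _ λ j → ∧-monotonic ≤-refl (omit-least n y j (λ i _ → ⋁-upper (suc n) y i))
      X∧Y′≤D : ∀ j → X ∧ omit n y′ j ≤ D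
      X∧Y′≤D j = begin
        X ∧ omit n y′ j      ≤⟨ ∧-greatest (≤-trans (x∧y≤y _ _) (omit-least n y′ j λ i i≢j →
                                  ∨-monotonic ≤-refl (omit-upper n y i≢j))) (x∧y≤x _ _) ⟩
        (D ∨ omit n y j) ∧ X ≤⟨ modular-law D≤X ⟩
        D ∨ (omit n y j ∧ X) ≤⟨ ∨-least ≤-refl (≤-trans (∧-greatest (≤-trans (x∧y≤y _ _) (x∧y≤x _ _)) (x∧y≤x _ _))
                                  (⋁-upper (suc n) (λ j → x ∧ omit n y j) j)) ⟩
        D                    ∎

-- Blocks of a glued sum as convex sublattices.

module GluedSum
  {S U : Set} (_≤_ : S → S → Set) (_∨_ _∧_ : S → S → S) (isLatticeS : IsLatticeS _≤_ _∨_ _∧_)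
  (Mem : S → U → Set) (R : S → U → U → Set) (Lat : (x : S) → LatticeOn (Mem x) (R x))
  (glued : IsGluedSystem _≤_ _∨_ _∧_ Mem R Lat)
  (ops : LatticeOps (GluedCarrier Mem) (GluedOrder Mem R))
  where

  open IsGluedSystem glued
  open IsLattice isLatticeS using (x≤x∨y; y≤x∨y; x∧y≤x; x∧y≤y) renaming (refl to ≤-refl; trans to ≤-trans)
  open LatticeOps ops renaming (_∨_ to _⊔_; _∧_ to _⊓_)
  private
    module Local x = LatticeOn (Lat x)
    module LocalPoset x = IsPosetOn (Local.isPoset x)
    _⊑_ = GluedOrder Mem R

  local⇒⊑ : ∀ {z a b} → Mem z a → Mem z b → R z a b → a ⊑ b
  local⇒⊑ a∈z b∈z r = [ _ , a∈z , b∈z , r ]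

  filter-closed : ∀ {x y p a} → x ≤ y → Mem x p → Mem y p → Mem x a → R x p a → Mem y a
  filter-closed x≤y p∈x p∈y a∈x r =
    let (_ , _ , up , _) , _ = glue-filter-ideal x≤y (_ , p∈x , p∈y)
    in proj₂ (up (p∈x , p∈y) a∈x r)

  ideal-closed : ∀ {x y p a} → x ≤ y → Mem x p → Mem y p → Mem y a → R y a p → Mem x a
  ideal-closed x≤y p∈x p∈y a∈y r =
    let _ , (_ , _ , down , _) = glue-filter-ideal x≤y (_ , p∈x , p∈y)
    in proj₁ (down (p∈x , p∈y) a∈y r)

  -- By `glue-meet-join`, `a` lies in the block of `v ∨ x`; the filter condition brings `b` along,
  -- and `glue-order` the relation.
  step-lift : ∀ {v a b} → Mem v a → GluedStep Mem R a b →
              ∃ λ w → v ≤ w × Mem w a × Mem w b × R w a b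
  step-lift {v} a∈v (x , a∈x , b∈x , r) =
    let a∈w = proj₂ (glue-meet-join (a∈v , a∈x))
        b∈w = filter-closed (y≤x∨y v x) a∈x a∈w b∈x r
    in v ∨ x , x≤x∨y v x , a∈w , b∈w , proj₁ (glue-order (y≤x∨y v x) (a∈x , a∈w) (b∈x , b∈w)) r

  ideal-pull : ∀ {z w a b} → z ≤ w → Mem w a → Mem w b → R w a b → Mem z b → Mem z a × R z a b
  ideal-pull z≤w a∈w b∈w r b∈z =
    let a∈z = ideal-closed z≤w b∈z b∈w a∈w r
    in a∈z , proj₂ (glue-order z≤w (a∈z , a∈w) (b∈z , b∈w)) r

  -- The index `v` is separate from `z` because it rises as the path is lifted. The relations in
  -- block `z` are then recovered backwards from `b` and composed there.
  path-pull : ∀ {z v a b} → z ≤ v → Mem v a → a ⊑ b → Mem z b → Mem z a × R z a b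
  path-pull z≤v a∈v [ s ] b∈z =
    let w , v≤w , a∈w , b∈w , r = step-lift a∈v s
    in ideal-pull (≤-trans z≤v v≤w) a∈w b∈w r b∈z
  path-pull {z} z≤v a∈v (s ∷ ss) b∈z =
    let w , v≤w , a∈w , c∈w , r = step-lift a∈v s
        z≤w = ≤-trans z≤v v≤w
        c∈z , r₂ = path-pull z≤w c∈w ss b∈z
        a∈z , r₁ = ideal-pull z≤w a∈w c∈w r c∈z
    in a∈z , LocalPoset.trans z a∈z c∈z b∈z r₁ r₂

  path-lift : ∀ {z a b} → Mem z a → a ⊑ b → ∃ λ v → z ≤ v × Mem v b
  path-lift a∈z [ s ] = let w , z≤w , _ , b∈w , _ = step-lift a∈z s in w , z≤w , b∈w
  path-lift a∈z (s ∷ ss) =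
    let w , z≤w , _ , c∈w , _ = step-lift a∈z s
        v , w≤v , b∈v = path-lift c∈w ss
    in v , ≤-trans z≤w w≤v , b∈v

  ⊑⇒local : ∀ {z a b} → Mem z a → Mem z b → a ⊑ b → R z a b
  ⊑⇒local a∈z b∈z a⊑b = proj₂ (path-pull ≤-refl a∈z a⊑b b∈z)

  -- Lifting from `a` finds a block of `b` with index above `z`, as `path-pull` needs to descend
  -- from `c`.
  Mem-convex : ∀ {z a b c} → Mem z a → Mem z c → a ⊑ b → b ⊑ c → Mem z b
  Mem-convex a∈z c∈z a⊑b b⊑c =
    let _ , z≤v , b∈v = path-lift a∈z a⊑b in proj₁ (path-pull z≤v b∈v b⊑c c∈z)

  -- A transitive closure may contain cycles; convexity confines any cycle here to a single block.
  ⊑-antisym : ∀ {a b} → GluedCarrier Mem a → a ⊑ b → b ⊑ a → a ≡ b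
  ⊑-antisym (z , a∈z) a⊑b b⊑a =
    let b∈z = Mem-convex a∈z a∈z a⊑b b⊑a
    in LocalPoset.antisym z a∈z b∈z (⊑⇒local a∈z b∈z a⊑b) (⊑⇒local b∈z a∈z b⊑a)

  module _ {z a b} (a∈z : Mem z a) (b∈z : Mem z b) where
    private
      open LatticeOps (Local.ops z) using () renaming (_∨_ to _⊔ᶻ_; _∧_ to _⊓ᶻ_)
      a∈ : GluedCarrier Mem a
      a∈ = z , a∈z
      b∈ : GluedCarrier Mem b
      b∈ = z , b∈z
      j∈z = Local.∨-closed z a∈z b∈z
      m∈z = Local.∧-closed z a∈z b∈z

      ⊔⊑⊔ᶻ : (a ⊔ b) ⊑ (a ⊔ᶻ b)
      ⊔⊑⊔ᶻ = ∨-least a∈ b∈ (z , j∈z) (local⇒⊑ a∈z j∈z (Local.∨-upperˡ z a∈z b∈z))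
                                      (local⇒⊑ b∈z j∈z (Local.∨-upperʳ z a∈z b∈z))

      ⊓ᶻ⊑⊓ : (a ⊓ᶻ b) ⊑ (a ⊓ b)
      ⊓ᶻ⊑⊓ = ∧-greatest a∈ b∈ (z , m∈z) (local⇒⊑ m∈z a∈z (Local.∧-lowerˡ z a∈z b∈z))
                                         (local⇒⊑ m∈z b∈z (Local.∧-lowerʳ z a∈z b∈z))

    -- The local join is an upper bound in the sum too, so `a ⊔ b` lies between `a` and it.
    Mem-⊔ : Mem z (a ⊔ b)
    Mem-⊔ = Mem-convex a∈z j∈z (∨-upperˡ a∈ b∈) ⊔⊑⊔ᶻ

    Mem-⊓ : Mem z (a ⊓ b)
    Mem-⊓ = Mem-convex m∈z a∈z ⊓ᶻ⊑⊓ (∧-lowerˡ a∈ b∈)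

    ⊔≡⊔ᶻ : a ⊔ b ≡ a ⊔ᶻ b
    ⊔≡⊔ᶻ = ⊑-antisym (z , Mem-⊔) ⊔⊑⊔ᶻ (local⇒⊑ j∈z Mem-⊔ (Local.∨-least z a∈z b∈z Mem-⊔
             (⊑⇒local a∈z Mem-⊔ (∨-upperˡ a∈ b∈)) (⊑⇒local b∈z Mem-⊔ (∨-upperʳ a∈ b∈))))

    ⊓≡⊓ᶻ : a ⊓ b ≡ a ⊓ᶻ b
    ⊓≡⊓ᶻ = ⊑-antisym (z , Mem-⊓) (local⇒⊑ Mem-⊓ m∈z (Local.∧-greatest z a∈z b∈z Mem-⊓
             (⊑⇒local Mem-⊓ a∈z (∧-lowerˡ a∈ b∈)) (⊑⇒local Mem-⊓ b∈z (∧-lowerʳ a∈ b∈)))) ⊓ᶻ⊑⊓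

  -- The atlas of the glued sum.

  Point : Set
  Point = ∃ (GluedCarrier Mem)

  -- Membership proofs are not unique, so points are compared by their first components.
  gluedLattice : Lattice 0ℓ 0ℓ 0ℓ
  gluedLattice = record
    { Carrier = Point
    ; _≈_ = λ a b → proj₁ a ≡ proj₁ b
    ; _≤_ = λ a b → proj₁ a ⊑ proj₁ b
    ; _∨_ = λ (a , a∈) (b , b∈) → a ⊔ b , ∨-closed a∈ b∈
    ; _∧_ = λ (a , a∈) (b , b∈) → a ⊓ b , ∧-closed a∈ b∈
    ; isLattice = record
      { isPartialOrder = record
        { isPreorder = record
          { isEquivalence = record { refl = refl ; sym = sym ; trans = trans }
          ; reflexive = λ { {_ , z , a∈z} refl → local⇒⊑ a∈z a∈z (LocalPoset.refl z a∈z) }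
          ; trans = _++_
          }
        ; antisym = λ { {_ , a∈} → ⊑-antisym a∈ }
        }
      ; supremum = λ (a , a∈) (b , b∈) → ∨-upperˡ a∈ b∈ , ∨-upperʳ a∈ b∈ , λ (c , c∈) → ∨-least a∈ b∈ c∈
      ; infimum  = λ (a , a∈) (b , b∈) → ∧-lowerˡ a∈ b∈ , ∧-lowerʳ a∈ b∈ , λ (c , c∈) → ∧-greatest a∈ b∈ c∈
      }
    }

  open Lattice gluedLattice using () renaming (_≤_ to _⊑ₚ_; _∨_ to _⊔ₚ_; _∧_ to _⊓ₚ_; reflexive to ⊑-reflexive)

  Block : S → Point → Set
  Block x (a , _) = Mem x a

  path : ∀ {a b} a∈ b∈ → a ⊑ b →
         Star (λ p q → p ⊑ₚ q × ∃ λ w → Block w p × Block w q) (a , a∈) (b , b∈)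
  path a∈ b∈ [ s@(x , a∈x , b∈x , _) ]      = ([ s ] , x , a∈x , b∈x) ◅ ε
  path a∈ b∈ (s@(x , a∈x , c∈x , _) ∷ c⊑b) = ([ s ] , x , a∈x , c∈x) ◅ path (x , c∈x) b∈ c⊑b

  -- Blocks are amalgamated at `x ∨ y` and `x ∧ y`. Both contain `p` by `glue-meet-join`; the filter
  -- condition carries along what lies above `p`, the ideal condition what lies below.
  gluedAtlas : (∀ x → Modular (Mem x) (R x) (Local.ops x)) → Atlas gluedLattice
  gluedAtlas local-modular = record
    { Index = S
    ; Block = Block
    ; convex = Mem-convex
    ; ∨-closed = Mem-⊔
    ; ∧-closed = Mem-⊓
    ; modular = λ {w} {a} {b} {c} → modular w a b c
    ; amalgam-up = λ {x} {y} p∈x p∈y → x ∨ y , λ where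
        p⊑a (inj₁ a∈x) → filter-closed (x≤x∨y x y) p∈x (proj₂ (glue-meet-join (p∈x , p∈y))) a∈x (⊑⇒local p∈x a∈x p⊑a)
        p⊑a (inj₂ a∈y) → filter-closed (y≤x∨y x y) p∈y (proj₂ (glue-meet-join (p∈x , p∈y))) a∈y (⊑⇒local p∈y a∈y p⊑a)
    ; amalgam-down = λ {x} {y} p∈x p∈y → x ∧ y , λ where
        a⊑p (inj₁ a∈x) → ideal-closed (x∧y≤x x y) (proj₁ (glue-meet-join (p∈x , p∈y))) p∈x a∈x (⊑⇒local a∈x p∈x a⊑p)
        a⊑p (inj₂ a∈y) → ideal-closed (x∧y≤y x y) (proj₁ (glue-meet-join (p∈x , p∈y))) p∈y a∈y (⊑⇒local a∈y p∈y a⊑p)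
    ; path = λ {p} {q} → path (proj₂ p) (proj₂ q)
    }
    where
    modular : ∀ w a b c → Block w a → Block w b → Block w c → a ⊑ₚ c → ((a ⊔ₚ b) ⊓ₚ c) ⊑ₚ (a ⊔ₚ (b ⊓ₚ c))
    modular w a b c a∈w b∈w c∈w a⊑c = ⊑-reflexive {(a ⊔ₚ b) ⊓ₚ c} {a ⊔ₚ (b ⊓ₚ c)} (
      trans (⊓≡⊓ᶻ (Mem-⊔ a∈w b∈w) c∈w)
      (trans (cong (λ t → Local._∧_ w t (proj₁ c)) (⊔≡⊔ᶻ a∈w b∈w))
      (trans (sym (local-modular w a∈w b∈w c∈w (⊑⇒local a∈w c∈w a⊑c)))
      (trans (cong (Local._∨_ w (proj₁ a)) (sym (⊓≡⊓ᶻ b∈w c∈w)))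
      (sym (⊔≡⊔ᶻ a∈w (Mem-⊓ b∈w c∈w)))))))

  -- Transfer of the laws from the blocks to the sum.

  module _ (n : ℕ) (local-distrib : ∀ x → NDistributive (Mem x) (R x) (Local.ops x) (suc n)) where
    open AtlasProperties (gluedAtlas (proj₁ ∘ local-distrib))
    open FiniteJoins gluedLattice using (omit)

    -- Inside one block `proj₁` respects joins and meets, so `⋁-homo` over `Block w` rewrites both
    -- sides in local operations.
    block-distrib : ∀ {w} x y → Block w x → (∀ i → Block w (y i)) →
      (x ⊓ₚ ⋁ _⊔ₚ_ (suc (suc n)) y) ⊑ₚ ⋁ _⊔ₚ_ (suc (suc n)) (λ j → x ⊓ₚ omit n y j)
    block-distrib {w} x y x∈w y∈w =
      let homo = λ k f {g} → ⋁-homo proj₁ (Block w) _⊔ₚ_ (Local._∨_ w) Mem-⊔ ⊔≡⊔ᶻ k f {g}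
          ⋁y∈w , ⋁y≡ = homo (suc n) y y∈w (λ _ → refl)
          omit-homo = λ j → homo n (y ∘ punchIn j) (y∈w ∘ punchIn j) (λ _ → refl)
          _ , ⋁≡ = homo (suc n) (λ j → x ⊓ₚ omit n y j)
            (λ j → Mem-⊓ x∈w (proj₁ (omit-homo j)))
            (λ j → trans (⊓≡⊓ᶻ x∈w (proj₁ (omit-homo j))) (cong (Local._∧_ w (proj₁ x)) (proj₂ (omit-homo j))))
      in ⊑-reflexive {x ⊓ₚ ⋁ _⊔ₚ_ (suc (suc n)) y} {⋁ _⊔ₚ_ (suc (suc n)) (λ j → x ⊓ₚ omit n y j)} (
           trans (⊓≡⊓ᶻ x∈w ⋁y∈w)
           (trans (cong (Local._∧_ w (proj₁ x)) ⋁y≡)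
           (trans (proj₂ (local-distrib w) (proj₁ x) (proj₁ ∘ y) x∈w y∈w)
           (sym ⋁≡))))

    glued-distributive : NDistributive (GluedCarrier Mem) _⊑_ ops (suc n)
    glued-distributive = modular , distrib
      where
      modular : Modular (GluedCarrier Mem) _⊑_ ops
      modular {a} {b} {c} a∈ b∈ c∈ a⊑c = ⊑-antisym (∨-closed a∈ (∧-closed b∈ c∈))
        (∨-least a∈ (∧-closed b∈ c∈) (∧-closed (∨-closed a∈ b∈) c∈)
          (∧-greatest (∨-closed a∈ b∈) c∈ a∈ (∨-upperˡ a∈ b∈) a⊑c)
          (∧-greatest (∨-closed a∈ b∈) c∈ (∧-closed b∈ c∈)
            (∧-lowerˡ b∈ c∈ ++ ∨-upperʳ a∈ b∈) (∧-lowerʳ b∈ c∈)))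
        (modular-law {a , a∈} {b , b∈} {c , c∈} a⊑c)

      distrib : ∀ x (y : Fin (suc (suc n)) → U) → GluedCarrier Mem x → (∀ i → GluedCarrier Mem (y i)) →
        x ⊓ ⋁ _⊔_ (suc (suc n)) y ≡ ⋁ _⊔_ (suc (suc n)) (λ j → x ⊓ ⋁ _⊔_ (suc n) (λ i → y (punchIn j i)))
      distrib x y x∈ y∈ =
        -- Here the predicate of `⋁-homo` is trivial: `proj₁` commutes with joins of points
        -- definitionally.
        let homo = λ k f {g} e → proj₂ (⋁-homo proj₁ (λ _ → ⊤) _⊔ₚ_ _⊔_ _ (λ _ _ → refl) k f {g} _ e)
            yₚ = λ i → y i , y∈ i
        in trans (sym (cong (x ⊓_) (homo (suc n) yₚ (λ _ → refl))))
           (trans (distrib-law n block-distrib (x , x∈) yₚ)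
           (homo (suc n) (λ j → (x , x∈) ⊓ₚ omit n yₚ j) (λ j → cong (x ⊓_) (homo n (yₚ ∘ punchIn j) (λ _ → refl)))))

theorem3p4 : (n : ℕ) → .{{_ : NonZero n}} →
    {S U : Set} (_≤_ : S → S → Set) (_∨_ _∧_ : S → S → S) →
    IsLatticeS _≤_ _∨_ _∧_ →
    FiniteLength (λ _ → ⊤) _≤_ →
    (Mem : S → U → Set) (R : S → U → U → Set)
    (Lat : (x : S) → LatticeOn (Mem x) (R x)) →
    IsGluedSystem _≤_ _∨_ _∧_ Mem R Lat →
    (∀ x → NDistributive (Mem x) (R x) (LatticeOn.ops (Lat x)) n) →
    (∀ x → FiniteLength (Mem x) (R x)) →
    (ops : LatticeOps (GluedCarrier Mem) (GluedOrder Mem R)) →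
    NDistributive (GluedCarrier Mem) (GluedOrder Mem R) ops n
theorem3p4 (suc n) _≤_ _∨_ _∧_ isLatticeS _ Mem R Lat glued local-distrib _ ops =
  GluedSum.glued-distributive _≤_ _∨_ _∧_ isLatticeS Mem R Lat glued ops n local-distrib
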